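{- Let $G$ be an Abelian group, let $A,B \subset G$ be finite non-empty sets, let $K$ be a real number with $|A+B| \leq K|B|$, and let $\delta \in (0,1]$. Then there is a set $X \subset A$ with $|X| \leq \delta^{ -1}(K-1)+1$ such that $$|(x+B) \cap (X+B)| \geq (1-\delta)|B| \quad \text{for all } x \in A.$$
   Context: For subsets $S,T$ of an Abelian group, $S+T:=\{s+t: s \in S, t\in T\}$, and $x+B:=\{x+b: b \in B\}$. -}

module Defs where

open import Level using (Level; _⊔_)
open import Algebra.Bundles using (AbelianGroup)
open import Axiom.ExcludedMiddle using (ExcludedMiddle)
open import Data.Nat.Base as ℕ using (ℕ)
import Data.Nat.Properties as ℕ
import Data.Integer.Base as ℤ
open import Data.Rational as ℚ using (ℚ; 0ℚ; 1ℚ; ½)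
import Data.Rational.Properties as ℚ
open import Data.Rational.Solver using (module +-*-Solver)
open import Data.List.Base
  using (List; length; map; filter; deduplicate; cartesianProductWith)
import Data.List.Membership.Setoid as Membership
import Data.List.Membership.DecSetoid as DecMembership
import Data.List.Relation.Binary.Subset.Setoid as Subset
open import Data.Product using (∃; ∃-syntax; _×_; _,_)
open import Relation.Binary.Bundles using (DecSetoid)
open import Relation.Binary.Definitions using (Decidable)
open import Relation.Binary.PropositionalEquality
  using (_≡_; refl; sym; trans; cong; cong₂; subst)
open import Relation.Nullary using (¬_; yes; no; contradiction)

------------------------------------------------------------------------
-- The real numbers, as Cauchy sequences of rationals.  Two sequences
-- represent the same real number when x ≤ y and y ≤ x.

IsCauchy : (ℕ → ℚ) → Set
IsCauchy s = ∀ ε → 0ℚ ℚ.< ε →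
  ∃[ N ] (∀ m n → N ℕ.≤ m → N ℕ.≤ n → ℚ.∣ s m ℚ.- s n ∣ ℚ.< ε)

record ℝ : Set where
  constructor mkℝ
  field
    seq    : ℕ → ℚ
    cauchy : IsCauchy seq

open ℝ public

infix 4 _<_ _≤_

_<_ : ℝ → ℝ → Set
x < y = ∃[ ε ] (0ℚ ℚ.< ε) ×
  (∃[ N ] (∀ n → N ℕ.≤ n → seq x n ℚ.+ ε ℚ.≤ seq y n))

_≤_ : ℝ → ℝ → Set
x ≤ y = ¬ (y < x)

private
  open ℚ.≤-Reasoning

  -- Abstract, since the with-abstractions below would otherwise unfold
  -- these proofs.
  abstract
    half-pos : ∀ {ε} → 0ℚ ℚ.< ε → 0ℚ ℚ.< ½ ℚ.* ε
    half-pos {ε} ε>0 =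
      subst (ℚ._< ½ ℚ.* ε) (ℚ.*-zeroʳ ½) (ℚ.*-monoʳ-<-pos ½ ε>0)

    half+half : ∀ ε → ½ ℚ.* ε ℚ.+ ½ ℚ.* ε ≡ ε
    half+half ε = trans (sym (ℚ.*-distribʳ-+ ε ½ ½)) (ℚ.*-identityˡ ε)

    *-pos : ∀ {p q} → 0ℚ ℚ.< p → 0ℚ ℚ.< q → 0ℚ ℚ.< p ℚ.* q
    *-pos {p} {q} p>0 q>0 = subst (ℚ._< p ℚ.* q) (ℚ.*-zeroʳ p)
      (ℚ.*-monoʳ-<-pos p {{ℚ.positive p>0}} q>0)

    *-mono : ∀ {p q r s} → 0ℚ ℚ.≤ p → 0ℚ ℚ.≤ s →
             p ℚ.≤ q → r ℚ.≤ s → p ℚ.* r ℚ.≤ q ℚ.* s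
    *-mono {p} {q} {r} {s} p≥0 s≥0 p≤q r≤s = ℚ.≤-trans
      (ℚ.*-monoˡ-≤-nonNeg p {{ℚ.nonNegative p≥0}} r≤s)
      (ℚ.*-monoʳ-≤-nonNeg s {{ℚ.nonNegative s≥0}} p≤q)

    share : ∀ {ε M} → 0ℚ ℚ.< ε → 0ℚ ℚ.< M →
            ∃[ η ] (0ℚ ℚ.< η) × (M ℚ.* η ≡ ε)
    share {ε} {M} ε>0 M>0 = M⁻¹ ℚ.* ε , *-pos M⁻¹>0 ε>0 , eq
      where
      instance
        M-pos : ℚ.Positive M
        M-pos = ℚ.positive M>0
        M-nz : ℚ.NonZero M
        M-nz = ℚ.pos⇒nonZero M
      M⁻¹ : ℚ
      M⁻¹ = ℚ.1/ M
      M⁻¹>0 : 0ℚ ℚ.< M⁻¹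
      M⁻¹>0 = ℚ.positive⁻¹ M⁻¹ {{ℚ.1/pos⇒pos M}}
      eq : M ℚ.* (M⁻¹ ℚ.* ε) ≡ ε
      eq = trans (sym (ℚ.*-assoc M M⁻¹ ε))
          (trans (cong (ℚ._* ε) (ℚ.*-inverseʳ M)) (ℚ.*-identityˡ ε))

  const-cauchy : ∀ q → IsCauchy (λ _ → q)
  const-cauchy q ε ε>0 =
    0 , λ _ _ _ _ → subst (λ d → ℚ.∣ d ∣ ℚ.< ε) (sym (ℚ.+-inverseʳ q)) ε>0

  +-cauchy : ∀ {s t} → IsCauchy s → IsCauchy t →
             IsCauchy (λ n → s n ℚ.+ t n)
  +-cauchy {s} {t} cs ct ε ε>0
    with cs (½ ℚ.* ε) (half-pos ε>0) | ct (½ ℚ.* ε) (half-pos ε>0)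
  ... | M , hM | N , hN = M ℕ.⊔ N , λ m n h k → begin-strict
    ℚ.∣ (s m ℚ.+ t m) ℚ.- (s n ℚ.+ t n) ∣
      ≡⟨ cong ℚ.∣_∣ (regroup (s m) (t m) (s n) (t n)) ⟩
    ℚ.∣ (s m ℚ.- s n) ℚ.+ (t m ℚ.- t n) ∣
      ≤⟨ ℚ.∣p+q∣≤∣p∣+∣q∣ (s m ℚ.- s n) (t m ℚ.- t n) ⟩
    ℚ.∣ s m ℚ.- s n ∣ ℚ.+ ℚ.∣ t m ℚ.- t n ∣
      <⟨ ℚ.+-mono-<
           (hM m n (ℕ.m⊔n≤o⇒m≤o M N h) (ℕ.m⊔n≤o⇒m≤o M N k))
           (hN m n (ℕ.m⊔n≤o⇒n≤o M N h) (ℕ.m⊔n≤o⇒n≤o M N k)) ⟩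
    ½ ℚ.* ε ℚ.+ ½ ℚ.* ε
      ≡⟨ half+half ε ⟩
    ε ∎
    where
    regroup : ∀ a b c d →
      (a ℚ.+ b) ℚ.- (c ℚ.+ d) ≡ (a ℚ.- c) ℚ.+ (b ℚ.- d)
    regroup = solve 4 (λ a b c d →
      (a :+ b) :- (c :+ d) := (a :- c) :+ (b :- d)) refl
      where open +-*-Solver

  neg-cauchy : ∀ {s} → IsCauchy s → IsCauchy (λ n → ℚ.- s n)
  neg-cauchy {s} cs ε ε>0 with cs ε ε>0
  ... | N , hN = N , λ m n h k → begin-strict
    ℚ.∣ (ℚ.- s m) ℚ.- (ℚ.- s n) ∣
      ≡⟨ cong ℚ.∣_∣ (regroup (s m) (s n)) ⟩
    ℚ.∣ s n ℚ.- s m ∣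
      <⟨ hN n m k h ⟩
    ε ∎
    where
    regroup : ∀ a b → (ℚ.- a) ℚ.- (ℚ.- b) ≡ b ℚ.- a
    regroup = solve 2 (λ a b → (:- a) :- (:- b) := b :- a) refl
      where open +-*-Solver

  abstract
    bounded : ∀ {s} → IsCauchy s →
      ∃[ M ] (0ℚ ℚ.< M) × (∃[ N ] (∀ n → N ℕ.≤ n → ℚ.∣ s n ∣ ℚ.≤ M))
    bounded {s} cs with cs 1ℚ (ℚ.positive⁻¹ 1ℚ)
    ... | N , hN = 1ℚ ℚ.+ ℚ.∣ s N ∣
      , ℚ.+-mono-<-≤ (ℚ.positive⁻¹ 1ℚ) (ℚ.0≤∣p∣ (s N))
      , N , λ n h → begin
        ℚ.∣ s n ∣
          ≡⟨ cong ℚ.∣_∣ (split (s n) (s N)) ⟩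
        ℚ.∣ (s n ℚ.- s N) ℚ.+ s N ∣
          ≤⟨ ℚ.∣p+q∣≤∣p∣+∣q∣ (s n ℚ.- s N) (s N) ⟩
        ℚ.∣ s n ℚ.- s N ∣ ℚ.+ ℚ.∣ s N ∣
          ≤⟨ ℚ.+-monoˡ-≤ ℚ.∣ s N ∣ (ℚ.<⇒≤ (hN n N h ℕ.≤-refl)) ⟩
        1ℚ ℚ.+ ℚ.∣ s N ∣ ∎
      where
      split : ∀ a b → a ≡ (a ℚ.- b) ℚ.+ b
      split = solve 2 (λ a b → a := (a :- b) :+ b) refl
        where open +-*-Solver

    *-distrib-- : ∀ a b c → a ℚ.* (b ℚ.- c) ≡ a ℚ.* b ℚ.- a ℚ.* c
    *-distrib-- a b c = trans (ℚ.*-distribˡ-+ a b (ℚ.- c))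
      (cong (a ℚ.* b ℚ.+_) (sym (ℚ.neg-distribʳ-* a c)))

    ∣*∣-bound : ∀ C ζ a d → 0ℚ ℚ.< C →
                ℚ.∣ a ∣ ℚ.≤ C → ℚ.∣ d ∣ ℚ.< ζ → ℚ.∣ a ℚ.* d ∣ ℚ.< C ℚ.* ζ
    ∣*∣-bound C ζ a d C>0 a≤C d<ζ = begin-strict
      ℚ.∣ a ℚ.* d ∣
        ≡⟨ ℚ.∣p*q∣≡∣p∣*∣q∣ a d ⟩
      ℚ.∣ a ∣ ℚ.* ℚ.∣ d ∣
        ≤⟨ ℚ.*-monoʳ-≤-nonNeg ℚ.∣ d ∣ {{ℚ.nonNegative (ℚ.0≤∣p∣ d)}} a≤C ⟩
      C ℚ.* ℚ.∣ d ∣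
        <⟨ ℚ.*-monoʳ-<-pos C {{ℚ.positive C>0}} d<ζ ⟩
      C ℚ.* ζ ∎

    *-close : ∀ a b c d P Q η θ → 0ℚ ℚ.< P → 0ℚ ℚ.< Q →
      ℚ.∣ a ∣ ℚ.≤ P → ℚ.∣ b ℚ.- d ∣ ℚ.< η →
      ℚ.∣ d ∣ ℚ.≤ Q → ℚ.∣ a ℚ.- c ∣ ℚ.< θ →
      ℚ.∣ a ℚ.* b ℚ.- c ℚ.* d ∣ ℚ.< P ℚ.* η ℚ.+ Q ℚ.* θ
    *-close a b c d P Q η θ P>0 Q>0 a≤P b-d<η d≤Q a-c<θ = begin-strict
      ℚ.∣ a ℚ.* b ℚ.- c ℚ.* d ∣
        ≡⟨ cong ℚ.∣_∣ regroup ⟩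
      ℚ.∣ a ℚ.* (b ℚ.- d) ℚ.+ d ℚ.* (a ℚ.- c) ∣
        ≤⟨ ℚ.∣p+q∣≤∣p∣+∣q∣ (a ℚ.* (b ℚ.- d)) (d ℚ.* (a ℚ.- c)) ⟩
      ℚ.∣ a ℚ.* (b ℚ.- d) ∣ ℚ.+ ℚ.∣ d ℚ.* (a ℚ.- c) ∣
        <⟨ ℚ.+-mono-< (∣*∣-bound P η a (b ℚ.- d) P>0 a≤P b-d<η)
                      (∣*∣-bound Q θ d (a ℚ.- c) Q>0 d≤Q a-c<θ) ⟩
      P ℚ.* η ℚ.+ Q ℚ.* θ ∎
      where
      telescope : ∀ x y z → x ℚ.- z ≡ (x ℚ.- y) ℚ.+ (y ℚ.- z)
      telescope = solve 3 (λ x y z → x :- z := (x :- y) :+ (y :- z)) refl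
        where open +-*-Solver
      regroup : a ℚ.* b ℚ.- c ℚ.* d ≡ a ℚ.* (b ℚ.- d) ℚ.+ d ℚ.* (a ℚ.- c)
      regroup = trans (telescope (a ℚ.* b) (a ℚ.* d) (c ℚ.* d))
        (cong₂ ℚ._+_ (sym (*-distrib-- a b d))
          (trans (cong₂ ℚ._-_ (ℚ.*-comm a d) (ℚ.*-comm c d))
                 (sym (*-distrib-- d a c))))

  *-cauchy : ∀ {s t} → IsCauchy s → IsCauchy t →
             IsCauchy (λ n → s n ℚ.* t n)
  *-cauchy {s} {t} cs ct ε ε>0 =
    let P , P>0 , N₁ , h₁ = bounded cs
        Q , Q>0 , N₂ , h₂ = bounded ct
        η , η>0 , Pη = share (half-pos ε>0) P>0
        θ , θ>0 , Qθ = share (half-pos ε>0) Q>0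
        N₃ , h₃ = ct η η>0
        N₄ , h₄ = cs θ θ>0
        le₁₂ : ∀ {n} → (N₁ ℕ.⊔ N₂) ℕ.⊔ (N₃ ℕ.⊔ N₄) ℕ.≤ n → N₁ ℕ.⊔ N₂ ℕ.≤ n
        le₁₂ h = ℕ.m⊔n≤o⇒m≤o _ (N₃ ℕ.⊔ N₄) h
        le₃₄ : ∀ {n} → (N₁ ℕ.⊔ N₂) ℕ.⊔ (N₃ ℕ.⊔ N₄) ℕ.≤ n → N₃ ℕ.⊔ N₄ ℕ.≤ n
        le₃₄ h = ℕ.m⊔n≤o⇒n≤o (N₁ ℕ.⊔ N₂) _ h
    in (N₁ ℕ.⊔ N₂) ℕ.⊔ (N₃ ℕ.⊔ N₄) , λ m n h k →
      subst (ℚ.∣ s m ℚ.* t m ℚ.- s n ℚ.* t n ∣ ℚ.<_)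
        (trans (cong₂ ℚ._+_ Pη Qθ) (half+half ε))
        (*-close (s m) (t m) (s n) (t n) P Q η θ P>0 Q>0
          (h₁ m (ℕ.m⊔n≤o⇒m≤o N₁ N₂ (le₁₂ h)))
          (h₃ m n (ℕ.m⊔n≤o⇒m≤o N₃ N₄ (le₃₄ h)) (ℕ.m⊔n≤o⇒m≤o N₃ N₄ (le₃₄ k)))
          (h₂ n (ℕ.m⊔n≤o⇒n≤o N₁ N₂ (le₁₂ k)))
          (h₄ m n (ℕ.m⊔n≤o⇒n≤o N₃ N₄ (le₃₄ h)) (ℕ.m⊔n≤o⇒n≤o N₃ N₄ (le₃₄ k))))

infixl 6 _+_ _-_
infixl 7 _*_
infix  8 -_

fromℕ : ℕ → ℝ
fromℕ n = mkℝ (λ _ → ℤ.+ n ℚ./ 1) (const-cauchy (ℤ.+ n ℚ./ 1))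

0ℝ 1ℝ : ℝ
0ℝ = fromℕ 0
1ℝ = fromℕ 1

_+_ : ℝ → ℝ → ℝ
x + y = mkℝ (λ n → seq x n ℚ.+ seq y n)
            (+-cauchy {seq x} {seq y} (cauchy x) (cauchy y))

-_ : ℝ → ℝ
- x = mkℝ (λ n → ℚ.- seq x n) (neg-cauchy {seq x} (cauchy x))

_-_ : ℝ → ℝ → ℝ
x - y = x + (- y)

_*_ : ℝ → ℝ → ℝ
x * y = mkℝ (λ n → seq x n ℚ.* seq y n)
            (*-cauchy {seq x} {seq y} (cauchy x) (cauchy y))

-- The first few terms of a sequence with positive limit may vanish; the
-- value given to the reciprocal of 0 there does not affect the limit.
invℚ : ℚ → ℚ
invℚ p with p ℚ.≟ 0ℚ
... | yes _   = 0ℚ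
... | no  p≢0 = (ℚ.1/ p) {{ℚ.≢-nonZero p≢0}}

invℚ-inverseʳ : ∀ {p} → 0ℚ ℚ.< p → p ℚ.* invℚ p ≡ 1ℚ
invℚ-inverseʳ {p} p>0 with p ℚ.≟ 0ℚ
... | yes p≡0 = contradiction (sym p≡0) (ℚ.<⇒≢ p>0)
... | no  p≢0 = ℚ.*-inverseʳ p {{ℚ.≢-nonZero p≢0}}

private
  abstract
    inv-close : ∀ e ε a b → 0ℚ ℚ.< e → e ℚ.≤ a → e ℚ.≤ b →
                ℚ.∣ b ℚ.- a ∣ ℚ.< (e ℚ.* e) ℚ.* ε →
                ℚ.∣ invℚ a ℚ.- invℚ b ∣ ℚ.< ε
    inv-close e ε a b e>0 e≤a e≤b hyp =
      ℚ.*-cancelˡ-<-nonNeg (e ℚ.* e) {{ℚ.nonNegative (ℚ.<⇒≤ (*-pos e>0 e>0))}}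
        (begin-strict
          (e ℚ.* e) ℚ.* ℚ.∣ d ∣
            ≤⟨ ℚ.*-monoʳ-≤-nonNeg ℚ.∣ d ∣ {{ℚ.nonNegative (ℚ.0≤∣p∣ d)}}
                 (*-mono (ℚ.<⇒≤ e>0) (ℚ.<⇒≤ b>0) e≤a e≤b) ⟩
          (a ℚ.* b) ℚ.* ℚ.∣ d ∣
            ≡⟨ cong (ℚ._* ℚ.∣ d ∣)
                 (sym (ℚ.0≤p⇒∣p∣≡p (ℚ.<⇒≤ (*-pos a>0 b>0)))) ⟩
          ℚ.∣ a ℚ.* b ∣ ℚ.* ℚ.∣ d ∣
            ≡⟨ sym (ℚ.∣p*q∣≡∣p∣*∣q∣ (a ℚ.* b) d) ⟩
          ℚ.∣ (a ℚ.* b) ℚ.* d ∣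
            ≡⟨ cong ℚ.∣_∣ clear ⟩
          ℚ.∣ b ℚ.- a ∣
            <⟨ hyp ⟩
          (e ℚ.* e) ℚ.* ε ∎)
      where
      d : ℚ
      d = invℚ a ℚ.- invℚ b
      a>0 : 0ℚ ℚ.< a
      a>0 = ℚ.<-≤-trans e>0 e≤a
      b>0 : 0ℚ ℚ.< b
      b>0 = ℚ.<-≤-trans e>0 e≤b
      cancel : ∀ p q → 0ℚ ℚ.< p → q ℚ.* (p ℚ.* invℚ p) ≡ q
      cancel p q p>0 =
        trans (cong (q ℚ.*_) (invℚ-inverseʳ p>0)) (ℚ.*-identityʳ q)
      clear : (a ℚ.* b) ℚ.* (invℚ a ℚ.- invℚ b) ≡ b ℚ.- a
      clear = trans (*-distrib-- (a ℚ.* b) (invℚ a) (invℚ b))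
        (cong₂ ℚ._-_
          (trans (cong (ℚ._* invℚ a) (ℚ.*-comm a b))
            (trans (ℚ.*-assoc b a (invℚ a)) (cancel a b a>0)))
          (trans (ℚ.*-assoc a b (invℚ b)) (cancel b a b>0)))

  inv-cauchy : ∀ x → 0ℝ < x → IsCauchy (λ n → invℚ (seq x n))
  inv-cauchy x (e , e>0 , N₁ , h₁) ε ε>0 =
    let N₂ , h₂ = cauchy x ((e ℚ.* e) ℚ.* ε) (*-pos (*-pos e>0 e>0) ε>0)
        far : ∀ n → N₁ ℕ.≤ n → e ℚ.≤ seq x n
        far n h = subst (ℚ._≤ seq x n) (ℚ.+-identityˡ e) (h₁ n h)
    in N₁ ℕ.⊔ N₂ , λ m n h k →
      inv-close e ε (seq x m) (seq x n) e>0
        (far m (ℕ.m⊔n≤o⇒m≤o N₁ N₂ h)) (far n (ℕ.m⊔n≤o⇒m≤o N₁ N₂ k))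
        (h₂ n m (ℕ.m⊔n≤o⇒n≤o N₁ N₂ k) (ℕ.m⊔n≤o⇒n≤o N₁ N₂ h))

inverse : (x : ℝ) → 0ℝ < x → ℝ
inverse x x>0 = mkℝ (λ n → invℚ (seq x n)) (inv-cauchy x x>0)

------------------------------------------------------------------------
-- Finite subsets of an Abelian group (written with stdlib's _∙_).  A
-- list stands for the set of its entries up to _≈_, in any order and
-- with repetitions allowed; excluded middle decides _≈_, so that
-- distinct elements can be counted.

module FiniteSubsets {c ℓ : Level}
  (em : ExcludedMiddle ℓ) (G : AbelianGroup c ℓ) where

  open AbelianGroup G using (Carrier; _≈_; _∙_; setoid; isEquivalence)

  _≟_ : Decidable _≈_
  x ≟ y = em

  decSetoid : DecSetoid c ℓ
  decSetoid = record
    { isDecEquivalence = record { isEquivalence = isEquivalence ; _≟_ = _≟_ } }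

  open Membership setoid public using (_∈_)
  open DecMembership decSetoid public using (_∈?_)
  open Subset setoid public using (_⊆_)

  infixl 6 _⊕_ _+ˢ_
  infixl 5 _∩_

  FinSubset : Set c
  FinSubset = List Carrier

  NonEmpty : FinSubset → Set (c ⊔ ℓ)
  NonEmpty S = ∃ λ x → x ∈ S

  _⊕_ : FinSubset → FinSubset → FinSubset
  S ⊕ T = cartesianProductWith _∙_ S T

  _+ˢ_ : Carrier → FinSubset → FinSubset
  x +ˢ B = map (x ∙_) B

  _∩_ : FinSubset → FinSubset → FinSubset
  S ∩ T = filter (_∈? T) S

  ∣_∣ : FinSubset → ℕ
  ∣ S ∣ = length (deduplicate _≟_ S)

-- Build X greedily, starting from one element of A and adding x ∈ A whenever
-- x + B meets X + B in fewer than (1 - δ)|B| points.  Each addition enlarges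
-- X + B by more than δ|B|, so |B| + δ(|X| - 1)|B| ≤ |X + B| ≤ |A + B| ≤ K|B|.
-- Since X + B only grows, one pass through A suffices.

module Submission where

open import Level using (Level; _⊔_; Lift; lift; lower)
open import Algebra.Bundles using (AbelianGroup)
import Algebra.Properties.Group as GroupProperties
open import Axiom.ExcludedMiddle using (ExcludedMiddle)
open import Data.Integer.Base as ℤ using (+_)
import Data.Integer.Properties as ℤ
open import Data.List.Base
  using ([]; _∷_; [_]; _++_; length; filter; deduplicate)
import Data.List.Membership.Setoid.Properties as Membership
import Data.List.Properties as List
import Data.List.Relation.Binary.Subset.Setoid.Properties as Subset
open import Data.List.Relation.Unary.All using (_∷_)
open import Data.List.Relation.Unary.AllPairs using (_∷_; [])
import Data.List.Relation.Unary.All.Properties as All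
open import Data.List.Relation.Unary.Any as Any using (here; there)
open import Data.List.Relation.Unary.Unique.DecSetoid.Properties
  using (deduplicate-!)
open import Data.List.Relation.Unary.Unique.Setoid using (Unique)
import Data.List.Relation.Unary.Unique.Setoid.Properties as Unique
open import Data.Nat.Base as ℕ using (ℕ; suc; z≤n; s≤s)
import Data.Nat.Properties as ℕ
open import Data.Product using (∃-syntax; _×_; _,_; proj₁; proj₂)
open import Data.Rational as ℚ using (ℚ; 0ℚ; 1ℚ)
import Data.Rational.Properties as ℚ
open import Data.Rational.Solver using (module +-*-Solver)
import Data.Rational.Unnormalised.Base as ℚᵘ
import Data.Rational.Unnormalised.Properties as ℚᵘ
open import Function using (_∘_)
open import Relation.Binary.PropositionalEquality
  using (_≡_; refl; sym; trans; cong; cong₂; subst; subst₂)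
open import Relation.Nullary using (¬_; Dec; yes; no; ¬?)
open import Relation.Nullary.Decidable using (map′)
open import Relation.Unary using (Pred; Decidable)
open import Defs

open +-*-Solver using (solve; con; _:=_; _:+_; _:*_; _:-_)

-- Naturals as rationals, and the rational inequalities behind the counting.

⟦_⟧ : ℕ → ℚ
⟦ n ⟧ = + n ℚ./ 1

-- Rational addition normalises by a gcd, so the identity is checked on unnormalised fractions,
-- where it is integer arithmetic over denominator 1.
⟦⟧-homo-+ : ∀ m n → ⟦ m ℕ.+ n ⟧ ≡ ⟦ m ⟧ ℚ.+ ⟦ n ⟧
⟦⟧-homo-+ m n = ℚ.toℚᵘ-injective (begin
  ℚ.toℚᵘ ⟦ m ℕ.+ n ⟧
    ≈⟨ ℚ.toℚᵘ-fromℚᵘ (ℚᵘ.mkℚᵘ (+ (m ℕ.+ n)) 0) ⟩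
  ℚᵘ.mkℚᵘ (+ (m ℕ.+ n)) 0
    ≈⟨ ℚᵘ.*≡* (cong (ℤ._* + 1) split) ⟩
  ℚᵘ.mkℚᵘ (+ m) 0 ℚᵘ.+ ℚᵘ.mkℚᵘ (+ n) 0
    ≈⟨ ℚᵘ.+-cong (ℚ.toℚᵘ-fromℚᵘ (ℚᵘ.mkℚᵘ (+ m) 0))
                 (ℚ.toℚᵘ-fromℚᵘ (ℚᵘ.mkℚᵘ (+ n) 0)) ⟨
  ℚ.toℚᵘ ⟦ m ⟧ ℚᵘ.+ ℚ.toℚᵘ ⟦ n ⟧
    ≈⟨ ℚ.toℚᵘ-homo-+ ⟦ m ⟧ ⟦ n ⟧ ⟨
  ℚ.toℚᵘ (⟦ m ⟧ ℚ.+ ⟦ n ⟧) ∎)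
  where
  open ℚᵘ.≃-Reasoning
  split : + (m ℕ.+ n) ≡ + m ℤ.* + 1 ℤ.+ + n ℤ.* + 1
  split = sym (cong₂ ℤ._+_ (ℤ.*-identityʳ (+ m)) (ℤ.*-identityʳ (+ n)))

0≤⟦⟧ : ∀ n → 0ℚ ℚ.≤ ⟦ n ⟧
0≤⟦⟧ n = ℚ.nonNegative⁻¹ ⟦ n ⟧ {{ℚ.normalize-nonNeg n 1}}

⟦⟧-mono-≤ : ∀ {m n} → m ℕ.≤ n → ⟦ m ⟧ ℚ.≤ ⟦ n ⟧
⟦⟧-mono-≤ {m} {n} m≤n = begin
  ⟦ m ⟧                    ≡⟨ ℚ.+-identityʳ ⟦ m ⟧ ⟨
  ⟦ m ⟧ ℚ.+ 0ℚ             ≤⟨ ℚ.+-monoʳ-≤ ⟦ m ⟧ (0≤⟦⟧ (n ℕ.∸ m)) ⟩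
  ⟦ m ⟧ ℚ.+ ⟦ n ℕ.∸ m ⟧    ≡⟨ ⟦⟧-homo-+ m (n ℕ.∸ m) ⟨
  ⟦ m ℕ.+ (n ℕ.∸ m) ⟧      ≡⟨ cong ⟦_⟧ (ℕ.m+[n∸m]≡n m≤n) ⟩
  ⟦ n ⟧                    ∎
  where open ℚ.≤-Reasoning

-- Reduces a linear inequality to the sum a ≤ b of its hypotheses and a ring
-- identity.
≤-from : ∀ {a b p q} → a ℚ.≤ b → p ℚ.+ b ≡ q ℚ.+ a → p ℚ.≤ q
≤-from {a} {b} {p} {q} a≤b eq = begin
  p                        ≡⟨ cancel p b ⟩
  (p ℚ.+ b) ℚ.- b          ≡⟨ cong (ℚ._- b) eq ⟩
  (q ℚ.+ a) ℚ.- b          ≤⟨ ℚ.+-monoˡ-≤ (ℚ.- b) (ℚ.+-monoʳ-≤ q a≤b) ⟩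
  (q ℚ.+ b) ℚ.- b          ≡⟨ cancel q b ⟨
  q                        ∎
  where
  open ℚ.≤-Reasoning
  cancel : ∀ x y → x ≡ (x ℚ.+ y) ℚ.- y
  cancel = solve 2 (λ x y → x := (x :+ y) :- y) refl

-- Here `k` = |X|, `b` = |B|, `s` and `s′` are |X + B| before and after adjoining x, and `i` is the
-- overlap of x + B with X + B. Each step gains `b - i`, which is at least `δ b`.
greedy-step : ∀ {δ k b s s′ i ε} →
  δ ℚ.* (k ℚ.- 1ℚ) ℚ.* b ℚ.+ b ℚ.≤ s →
  i ℚ.+ ε ℚ.≤ (1ℚ ℚ.- δ) ℚ.* b → 0ℚ ℚ.≤ ε →
  b ℚ.+ s ℚ.≤ s′ ℚ.+ i →
  δ ℚ.* ((1ℚ ℚ.+ k) ℚ.- 1ℚ) ℚ.* b ℚ.+ b ℚ.≤ s′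
greedy-step {δ} {k} {b} {s} {s′} {i} {ε} h₁ h₂ h₃ h₄ =
  ≤-from (ℚ.+-mono-≤ h₁ (ℚ.+-mono-≤ h₂ (ℚ.+-mono-≤ h₃ h₄)))
    (solve 7 (λ δ k b s s′ i ε →
      (δ :* ((con 1ℚ :+ k) :- con 1ℚ) :* b :+ b)
        :+ (s :+ ((con 1ℚ :- δ) :* b :+ (ε :+ (s′ :+ i))))
      := s′ :+ ((δ :* (k :- con 1ℚ) :* b :+ b)
        :+ ((i :+ ε) :+ (con 0ℚ :+ (b :+ s)))))
      refl δ k b s s′ i ε)

-- Multiplying the excess `h₂` by `δ b` and inserting it in `h₁` gives `s ≥ K b + δ b ε`. Replacing
-- `δ b` by its lower bound `e` yields a gap that does not depend on the index of the Cauchy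
-- sequences, as `<` on reals demands.
overshoot : ∀ {δ v k b s K e ε} → δ ℚ.* v ≡ 1ℚ → 0ℚ ℚ.≤ e → e ℚ.≤ δ →
  0ℚ ℚ.≤ ε → 1ℚ ℚ.≤ b →
  δ ℚ.* (k ℚ.- 1ℚ) ℚ.* b ℚ.+ b ℚ.≤ s →
  v ℚ.* (K ℚ.- 1ℚ) ℚ.+ 1ℚ ℚ.+ ε ℚ.≤ k →
  K ℚ.* b ℚ.+ e ℚ.* ε ℚ.≤ s
overshoot {δ} {v} {k} {b} {s} {K} {e} {ε} δv≡1 0≤e e≤δ 0≤ε 1≤b h₁ h₂ =
  ≤-from (ℚ.+-mono-≤ h₁ (ℚ.+-mono-≤ scaled eε≤δbε))
    (solve 7 (λ δ k b s K e ε →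
      (K :* b :+ e :* ε) :+ (s :+ (δ :* b :* k :+ δ :* b :* ε))
      := s :+ ((δ :* (k :- con 1ℚ) :* b :+ b)
        :+ ((con 1ℚ :* ((K :- con 1ℚ) :* b) :+ (δ :* b :+ δ :* b :* ε))
        :+ e :* ε)))
      refl δ k b s K e ε)
  where
  open ℚ.≤-Reasoning
  0≤δ : 0ℚ ℚ.≤ δ
  0≤δ = ℚ.≤-trans 0≤e e≤δ
  δ≤δb : δ ℚ.≤ δ ℚ.* b
  δ≤δb = subst (ℚ._≤ δ ℚ.* b) (ℚ.*-identityʳ δ)
    (ℚ.*-monoˡ-≤-nonNeg δ {{ℚ.nonNegative 0≤δ}} 1≤b)
  eε≤δbε : e ℚ.* ε ℚ.≤ δ ℚ.* b ℚ.* ε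
  eε≤δbε = ℚ.*-monoʳ-≤-nonNeg ε {{ℚ.nonNegative 0≤ε}} (ℚ.≤-trans e≤δ δ≤δb)
  -- The explicit factor `1ℚ` marks where `δ ℚ.* v` is substituted, an equation the ring solver
  -- cannot use.
  scaled : 1ℚ ℚ.* ((K ℚ.- 1ℚ) ℚ.* b) ℚ.+ (δ ℚ.* b ℚ.+ δ ℚ.* b ℚ.* ε)
           ℚ.≤ δ ℚ.* b ℚ.* k
  scaled = begin
    1ℚ ℚ.* ((K ℚ.- 1ℚ) ℚ.* b) ℚ.+ (δ ℚ.* b ℚ.+ δ ℚ.* b ℚ.* ε)
      ≡⟨ cong (λ u → u ℚ.* ((K ℚ.- 1ℚ) ℚ.* b)
                       ℚ.+ (δ ℚ.* b ℚ.+ δ ℚ.* b ℚ.* ε)) δv≡1 ⟨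
    δ ℚ.* v ℚ.* ((K ℚ.- 1ℚ) ℚ.* b) ℚ.+ (δ ℚ.* b ℚ.+ δ ℚ.* b ℚ.* ε)
      ≡⟨ solve 5 (λ δ v b K ε →
           δ :* v :* ((K :- con 1ℚ) :* b) :+ (δ :* b :+ δ :* b :* ε)
           := δ :* b :* (v :* (K :- con 1ℚ) :+ con 1ℚ :+ ε))
           refl δ v b K ε ⟩
    δ ℚ.* b ℚ.* (v ℚ.* (K ℚ.- 1ℚ) ℚ.+ 1ℚ ℚ.+ ε)
      ≤⟨ ℚ.*-monoˡ-≤-nonNeg (δ ℚ.* b)
           {{ℚ.nonNegative (ℚ.≤-trans 0≤δ δ≤δb)}} h₂ ⟩
    δ ℚ.* b ℚ.* k ∎

-- Comparisons of reals through eventual rational bounds.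

fromℕ-≤-trans : ∀ {m n} x → x ≤ fromℕ m → m ℕ.≤ n → x ≤ fromℕ n
fromℕ-≤-trans x x≤m m≤n (ε , ε>0 , N , h) =
  x≤m (ε , ε>0 , N , λ n N≤n →
    ℚ.≤-trans (ℚ.+-monoˡ-≤ ε (⟦⟧-mono-≤ m≤n)) (h n N≤n))

eventually-positive : ∀ x → 0ℝ < x →
  ∃[ e ] 0ℚ ℚ.< e × ∃[ N ] (∀ n → N ℕ.≤ n → e ℚ.≤ seq x n)
eventually-positive x (e , e>0 , N , h) =
  e , e>0 , N , λ n N≤n → subst (ℚ._≤ seq x n) (ℚ.+-identityˡ e) (h n N≤n)

[1-x]*n≤n : ∀ x → 0ℝ < x → ∀ n → (1ℝ - x) * fromℕ n ≤ fromℕ n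
[1-x]*n≤n x x>0 n (ε , ε>0 , M , h) with eventually-positive x x>0
-- At the index `M ⊔ N` the assumed gap `ε` and the bound `0 ≤ x n` both hold, and together they
-- force `ε ≤ 0`.
... | e , e>0 , N , far = ℚ.<-irrefl refl (ℚ.<-≤-trans ε>0
  (≤-from (ℚ.+-mono-≤ (h (M ℕ.⊔ N) (ℕ.m≤m⊔n M N)) 0≤x*n)
    (solve 3 (λ ε x n →
      ε :+ ((con 1ℚ :- x) :* n :+ x :* n)
      := con 0ℚ :+ ((n :+ ε) :+ con 0ℚ)) refl ε y ⟦ n ⟧)))
  where
  y : ℚ
  y = seq x (M ℕ.⊔ N)
  0≤x*n : 0ℚ ℚ.≤ y ℚ.* ⟦ n ⟧
  0≤x*n = subst (ℚ._≤ y ℚ.* ⟦ n ⟧) (ℚ.*-zeroˡ ⟦ n ⟧)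
    (ℚ.*-monoʳ-≤-nonNeg ⟦ n ⟧ {{ℚ.nonNegative (0≤⟦⟧ n)}}
      (ℚ.≤-trans (ℚ.<⇒≤ e>0) (far _ (ℕ.m≤n⊔m M N))))

-- Cardinalities of finite subsets.

length-filter-∁ : ∀ {a p} {A : Set a} {P : Pred A p} (P? : Decidable P) xs →
  length (filter P? xs) ℕ.+ length (filter (¬? ∘ P?) xs) ≡ length xs
length-filter-∁ P? []       = refl
length-filter-∁ P? (x ∷ xs) with P? x
... | yes _ = cong suc (length-filter-∁ P? xs)
... | no  _ = trans (ℕ.+-suc _ _) (cong suc (length-filter-∁ P? xs))

module _ {c ℓ : Level} (em : ExcludedMiddle ℓ) (G : AbelianGroup c ℓ) where

  open AbelianGroup G
    using (Carrier; _≈_; _∙_; ∙-cong; ∙-congˡ; ∙-congʳ; setoid; group)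
    renaming (refl to ≈-refl; sym to ≈-sym; trans to ≈-trans)
  open FiniteSubsets em G

  ∈-resp : ∀ {S x y} → x ≈ y → x ∈ S → y ∈ S
  ∈-resp = Membership.∈-resp-≈ setoid

  -- Pigeonhole by induction on `U`: deleting from `V` every entry equal to the head `u` shortens
  -- `V`, and the tail of `U` survives the deletion because it does not contain `u`.
  unique-⊆⇒length≤ : ∀ {U V} → Unique setoid U → U ⊆ V → length U ℕ.≤ length V
  unique-⊆⇒length≤ {[]}    {V} []          U⊆V = z≤n
  unique-⊆⇒length≤ {u ∷ U} {V} (u∉U ∷ U!) U⊆V = ℕ.≤-trans
    (s≤s (unique-⊆⇒length≤ U! U⊆V∖u))
    (List.filter-notAll ≉u? V (Any.map (λ u≈v u≉v → u≉v u≈v) (U⊆V (here ≈-refl))))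
    where
    ≉u? : Decidable (λ v → ¬ u ≈ v)
    ≉u? v = ¬? (u ≟ v)
    U⊆V∖u : U ⊆ filter ≉u? V
    U⊆V∖u v∈U = Membership.∈-filter⁺ setoid ≉u?
      (λ v≈w u≉v u≈w → u≉v (≈-trans u≈w (≈-sym v≈w)))
      (U⊆V (there v∈U))
      (λ u≈v → All.All¬⇒¬Any u∉U (∈-resp (≈-sym u≈v) v∈U))

  ∈-deduplicate⁺ : ∀ {S} → S ⊆ deduplicate _≟_ S
  ∈-deduplicate⁺ = Membership.∈-deduplicate⁺ setoid _≟_
    (λ z≈y x≈y → ≈-trans x≈y (≈-sym z≈y))

  ∈-deduplicate⁻ : ∀ S → deduplicate _≟_ S ⊆ S
  ∈-deduplicate⁻ S = Membership.∈-deduplicate⁻ setoid _≟_ S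

  unique-⊆⇒length≤∣∣ : ∀ {U S} → Unique setoid U → U ⊆ S → length U ℕ.≤ ∣ S ∣
  unique-⊆⇒length≤∣∣ U! U⊆S = unique-⊆⇒length≤ U! (∈-deduplicate⁺ ∘ U⊆S)

  ∣∣-mono : ∀ {S T} → S ⊆ T → ∣ S ∣ ℕ.≤ ∣ T ∣
  ∣∣-mono {S} S⊆T =
    unique-⊆⇒length≤∣∣ (deduplicate-! decSetoid S) (S⊆T ∘ ∈-deduplicate⁻ S)

  ∣∣≤length : ∀ S → ∣ S ∣ ℕ.≤ length S
  ∣∣≤length S = unique-⊆⇒length≤ (deduplicate-! decSetoid S) (∈-deduplicate⁻ S)

  nonEmpty⇒∣∣≥1 : ∀ {S} → NonEmpty S → 1 ℕ.≤ ∣ S ∣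
  nonEmpty⇒∣∣≥1 (x , x∈S) = Membership.∈-length setoid (∈-deduplicate⁺ x∈S)

  ∈-∩⁺ : ∀ {S T x} → x ∈ S → x ∈ T → x ∈ S ∩ T
  ∈-∩⁺ {T = T} = Membership.∈-filter⁺ setoid (_∈? T) ∈-resp

  ∈-∩⁻ : ∀ {S T x} → x ∈ S ∩ T → x ∈ S × x ∈ T
  ∈-∩⁻ {T = T} = Membership.∈-filter⁻ setoid (_∈? T) ∈-resp

  -- Inclusion-exclusion, with `++` as union. The elements of `S` split into those in `T`, counted
  -- by `S ∩ T`, and those outside, which together with `T` form a repetition-free list inside the
  -- union.
  ∣∣+∣∣≤∣++∣+∣∩∣ : ∀ S T → ∣ S ∣ ℕ.+ ∣ T ∣ ℕ.≤ ∣ S ++ T ∣ ℕ.+ ∣ S ∩ T ∣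
  ∣∣+∣∣≤∣++∣+∣∩∣ S T = begin
    ∣ S ∣ ℕ.+ ∣ T ∣
      ≡⟨ cong (ℕ._+ ∣ T ∣) (length-filter-∁ (_∈? T) U) ⟨
    (length in-T ℕ.+ length out-T) ℕ.+ length V
      ≡⟨ ℕ.+-assoc (length in-T) _ _ ⟩
    length in-T ℕ.+ (length out-T ℕ.+ length V)
      ≡⟨ cong (length in-T ℕ.+_) (List.length-++ out-T) ⟨
    length in-T ℕ.+ length (out-T ++ V)
      ≤⟨ ℕ.+-mono-≤ (unique-⊆⇒length≤∣∣ in-T! in-T⊆) (unique-⊆⇒length≤∣∣ ++! ++⊆) ⟩
    ∣ S ∩ T ∣ ℕ.+ ∣ S ++ T ∣
      ≡⟨ ℕ.+-comm ∣ S ∩ T ∣ _ ⟩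
    ∣ S ++ T ∣ ℕ.+ ∣ S ∩ T ∣ ∎
    where
    open ℕ.≤-Reasoning
    U V in-T out-T : FinSubset
    U = deduplicate _≟_ S
    V = deduplicate _≟_ T
    in-T = filter (_∈? T) U
    out-T = filter (¬? ∘ (_∈? T)) U
    U! : Unique setoid U
    U! = deduplicate-! decSetoid S
    in-T! : Unique setoid in-T
    in-T! = Unique.filter⁺ setoid (_∈? T) U!
    in-T⊆ : in-T ⊆ S ∩ T
    in-T⊆ x∈ with ∈-∩⁻ {U} {T} x∈
    ... | x∈U , x∈T = ∈-∩⁺ {S} {T} (∈-deduplicate⁻ S x∈U) x∈T
    out-T⁻ : ∀ {x} → x ∈ out-T → x ∈ U × ¬ x ∈ T
    out-T⁻ = Membership.∈-filter⁻ setoid (¬? ∘ (_∈? T))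
      (λ x≈y x∉T y∈T → x∉T (∈-resp (≈-sym x≈y) y∈T))
    ++! : Unique setoid (out-T ++ V)
    ++! = Unique.++⁺ setoid (Unique.filter⁺ setoid (¬? ∘ (_∈? T)) U!)
      (deduplicate-! decSetoid T)
      (λ (x∈out , x∈V) → proj₂ (out-T⁻ x∈out) (∈-deduplicate⁻ T x∈V))
    ++⊆ : out-T ++ V ⊆ S ++ T
    ++⊆ = Subset.++⁺ setoid
      (∈-deduplicate⁻ S ∘ proj₁ ∘ out-T⁻) (∈-deduplicate⁻ T)

  -- Translates and sumsets.

  -- Translation is injective by cancellation, so it keeps a repetition-free list repetition-free.
  ∣∣≤∣+ˢ∣ : ∀ x B → ∣ B ∣ ℕ.≤ ∣ x +ˢ B ∣
  ∣∣≤∣+ˢ∣ x B = subst (ℕ._≤ ∣ x +ˢ B ∣) (List.length-map (x ∙_) (deduplicate _≟_ B))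
    (unique-⊆⇒length≤∣∣
      (Unique.map⁺ setoid setoid (GroupProperties.∙-cancelˡ group x _ _)
        (deduplicate-! decSetoid B))
      (Subset.map⁺ setoid setoid ∙-congˡ (∈-deduplicate⁻ B)))

  +ˢ-resp-≈ : ∀ {x y} B → x ≈ y → x +ˢ B ⊆ y +ˢ B
  +ˢ-resp-≈ B x≈y v∈ with Membership.∈-map⁻ setoid setoid v∈
  ... | b , b∈B , v≈ = ∈-resp (≈-sym (≈-trans v≈ (∙-congʳ x≈y)))
    (Membership.∈-map⁺ setoid setoid ∙-congˡ b∈B)

  +ˢ⊆⊕ : ∀ {x X} B → x ∈ X → x +ˢ B ⊆ X ⊕ B
  +ˢ⊆⊕ B x∈X v∈ with Membership.∈-map⁻ setoid setoid v∈
  ... | b , b∈B , v≈ = ∈-resp (≈-sym v≈)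
    (Membership.∈-cartesianProductWith⁺ setoid setoid setoid ∙-cong x∈X b∈B)

  ⊕-monoˡ : ∀ {X Y} B → X ⊆ Y → X ⊕ B ⊆ Y ⊕ B
  ⊕-monoˡ {X} B X⊆Y v∈
    with Membership.∈-cartesianProductWith⁻ setoid setoid setoid _∙_ X B v∈
  ... | x , b , x∈X , b∈B , v≈ = ∈-resp (≈-sym v≈)
    (Membership.∈-cartesianProductWith⁺ setoid setoid setoid ∙-cong (X⊆Y x∈X) b∈B)

  insert-second : ∀ {a y A} → a ∷ A ⊆ a ∷ y ∷ A
  insert-second (here v≈a)  = here v≈a
  insert-second (there v∈A) = there (there v∈A)

  -- The greedy choice of X and the bound on its size.

  module Greedy (B : FinSubset) (δ : ℝ) (δ>0 : 0ℝ < δ) where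

    common : Carrier → FinSubset → FinSubset
    common x X = (x +ˢ B) ∩ (X ⊕ B)

    Covers : FinSubset → Carrier → Set
    Covers X x = (1ℝ - δ) * fromℕ ∣ B ∣ ≤ fromℕ ∣ common x X ∣

    sparse? : ∀ X x → Dec (fromℕ ∣ common x X ∣ < (1ℝ - δ) * fromℕ ∣ B ∣)
    sparse? X x = map′ lower lift (em {Lift ℓ _})

    -- The intersection in `common` can only grow with `X`, so elements already covered stay
    -- covered.
    covers-mono : ∀ {X Y x y} → X ⊆ Y → x ≈ y → Covers X x → Covers Y y
    covers-mono {X} {Y} {x} {y} X⊆Y x≈y cov =
      fromℕ-≤-trans ((1ℝ - δ) * fromℕ ∣ B ∣) cov
        (∣∣-mono {common x X} {common y Y} common⊆)
      where
      common⊆ : common x X ⊆ common y Y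
      common⊆ v∈ with ∈-∩⁻ {x +ˢ B} {X ⊕ B} v∈
      ... | v∈x+B , v∈X⊕B =
        ∈-∩⁺ {y +ˢ B} {Y ⊕ B} (+ˢ-resp-≈ B x≈y v∈x+B) (⊕-monoˡ {X} {Y} B X⊆Y v∈X⊕B)

    -- For `x ∈ X` the translate x + B lies inside X + B, so the intersection has at least |B|
    -- elements.
    ∈⇒covers : ∀ {X x} → x ∈ X → Covers X x
    ∈⇒covers {X} {x} x∈X =
      fromℕ-≤-trans ((1ℝ - δ) * fromℕ ∣ B ∣) ([1-x]*n≤n δ δ>0 ∣ B ∣)
        (ℕ.≤-trans (∣∣≤∣+ˢ∣ x B)
          (∣∣-mono {x +ˢ B} {common x X}
            (λ v∈ → ∈-∩⁺ {x +ˢ B} {X ⊕ B} v∈ (+ˢ⊆⊕ {x} {X} B x∈X v∈))))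

    -- A strict inequality between reals holds eventually for the rational
    -- approximations, so the growth bound needs no error term.
    Growth : FinSubset → Set
    Growth X = ∃[ N ] (∀ n → N ℕ.≤ n →
      seq δ n ℚ.* (⟦ length X ⟧ ℚ.- 1ℚ) ℚ.* ⟦ ∣ B ∣ ⟧ ℚ.+ ⟦ ∣ B ∣ ⟧
        ℚ.≤ ⟦ ∣ X ⊕ B ∣ ⟧)

    growth-singleton : ∀ x → Growth [ x ]
    growth-singleton x = 0 , λ n _ → subst (ℚ._≤ ⟦ ∣ [ x ] ⊕ B ∣ ⟧)
      (solve 2 (λ d b → b := d :* (con 1ℚ :- con 1ℚ) :* b :+ b) refl
        (seq δ n) ⟦ ∣ B ∣ ⟧)
      (⟦⟧-mono-≤ (ℕ.≤-trans (∣∣≤∣+ˢ∣ x B)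
        (∣∣-mono {x +ˢ B} {[ x ] ⊕ B} (+ˢ⊆⊕ {x} {[ x ]} B (here ≈-refl)))))

    growth-∷ : ∀ x X → Growth X →
      fromℕ ∣ common x X ∣ < (1ℝ - δ) * fromℕ ∣ B ∣ → Growth (x ∷ X)
    growth-∷ x X (M , h) (ε , ε>0 , N , k) = M ℕ.⊔ N , λ n M⊔N≤n →
      subst (λ l → seq δ n ℚ.* (l ℚ.- 1ℚ) ℚ.* ⟦ ∣ B ∣ ⟧ ℚ.+ ⟦ ∣ B ∣ ⟧
                   ℚ.≤ ⟦ ∣ (x ∷ X) ⊕ B ∣ ⟧)
        (sym (⟦⟧-homo-+ 1 (length X)))
        (greedy-step
          {seq δ n} {⟦ length X ⟧} {⟦ ∣ B ∣ ⟧} {⟦ ∣ X ⊕ B ∣ ⟧}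
          {⟦ ∣ (x ∷ X) ⊕ B ∣ ⟧} {⟦ ∣ common x X ∣ ⟧} {ε}
          (h n (ℕ.m⊔n≤o⇒m≤o M N M⊔N≤n))
          (k n (ℕ.m⊔n≤o⇒n≤o M N M⊔N≤n)) (ℚ.<⇒≤ ε>0) inclusion-exclusion)
      where
      inclusion-exclusion :
        ⟦ ∣ B ∣ ⟧ ℚ.+ ⟦ ∣ X ⊕ B ∣ ⟧
          ℚ.≤ ⟦ ∣ (x ∷ X) ⊕ B ∣ ⟧ ℚ.+ ⟦ ∣ common x X ∣ ⟧
      inclusion-exclusion = subst₂ ℚ._≤_
        (⟦⟧-homo-+ ∣ B ∣ ∣ X ⊕ B ∣)
        (⟦⟧-homo-+ ∣ (x ∷ X) ⊕ B ∣ ∣ common x X ∣)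
        -- `(x ∷ X) ⊕ B` unfolds to `(x +ˢ B) ++ (X ⊕ B)`, the union to which inclusion-exclusion
        -- applies.
        (⟦⟧-mono-≤ (ℕ.≤-trans (ℕ.+-monoˡ-≤ ∣ X ⊕ B ∣ (∣∣≤∣+ˢ∣ x B))
          (∣∣+∣∣≤∣++∣+∣∩∣ (x +ˢ B) (X ⊕ B))))

    GreedyCover : FinSubset → Set (c ⊔ ℓ)
    GreedyCover A =
      ∃[ X ] X ⊆ A × Growth X × ((x : Carrier) → x ∈ A → Covers X x)

    extend : ∀ a A y (X : FinSubset) → X ⊆ a ∷ A → Growth X →
      (∀ x → x ∈ a ∷ A → Covers X x) →
      Dec (fromℕ ∣ common y X ∣ < (1ℝ - δ) * fromℕ ∣ B ∣) →
      GreedyCover (a ∷ y ∷ A)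
    extend a A y X X⊆ gr cov (yes sparse) =
      y ∷ X , y∷X⊆ , growth-∷ y X gr sparse , cov′
      where
      y∷X⊆ : y ∷ X ⊆ a ∷ y ∷ A
      y∷X⊆ (here v≈y)  = there (here v≈y)
      y∷X⊆ (there v∈X) = insert-second (X⊆ v∈X)
      keep : ∀ x → x ∈ a ∷ A → Covers (y ∷ X) x
      keep x x∈ = covers-mono {X} {y ∷ X} {x} {x} there ≈-refl (cov x x∈)
      cov′ : ∀ x → x ∈ a ∷ y ∷ A → Covers (y ∷ X) x
      cov′ x (here x≈a)          = keep x (here x≈a)
      cov′ x (there (here x≈y))  = ∈⇒covers {y ∷ X} {x} (here x≈y)
      cov′ x (there (there x∈A)) = keep x (there x∈A)
    -- As `≤` is by definition the negation of `<`, `covered` is already a proof of `Covers X y`.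
    extend a A y X X⊆ gr cov (no covered) = X , insert-second ∘ X⊆ , gr , cov′
      where
      cov′ : ∀ x → x ∈ a ∷ y ∷ A → Covers X x
      cov′ x (here x≈a)          = cov x (here x≈a)
      cov′ x (there (here x≈y))  =
        covers-mono {X} {X} {y} {x} (λ v∈ → v∈) (≈-sym x≈y) covered
      cov′ x (there (there x∈A)) = cov x (there x∈A)

    -- The recursion starts from a singleton: for the empty list `Growth` would ask for (1 - δ)|B| ≤
    -- 0.
    greedy : ∀ a A → GreedyCover (a ∷ A)
    greedy a [] =
      [ a ] , (λ x∈ → x∈) , growth-singleton a , λ x → ∈⇒covers {[ a ]} {x}
    greedy a (y ∷ A) =
      let X , X⊆ , gr , cov = greedy a A
      in extend a A y X X⊆ gr cov (sparse? X y)

    -- By contradiction: if |X| exceeds the bound by `ε`, then `overshoot` gives K|B| < |X + B| ≤ |A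
    -- + B|.
    growth⇒size-bound : ∀ A X → NonEmpty B → X ⊆ A → Growth X →
      ∀ K → fromℕ ∣ A ⊕ B ∣ ≤ K * fromℕ ∣ B ∣ →
      fromℕ ∣ X ∣ ≤ inverse δ δ>0 * (K - 1ℝ) + 1ℝ
    growth⇒size-bound A X B≢∅ X⊆A (N₁ , h₁) K A⊕B≤KB (ε , ε>0 , N₂ , h₂) =
      let e , e>0 , N₃ , h₃ = eventually-positive δ δ>0
      in A⊕B≤KB
        ( e ℚ.* ε
        , subst (ℚ._< e ℚ.* ε) (ℚ.*-zeroʳ e)
            (ℚ.*-monoʳ-<-pos e {{ℚ.positive e>0}} ε>0)
        , N₁ ℕ.⊔ N₂ ℕ.⊔ N₃
        , λ n N≤n →
          let N₁₂≤n = ℕ.m⊔n≤o⇒m≤o (N₁ ℕ.⊔ N₂) N₃ N≤n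
              e≤δ   = h₃ n (ℕ.m⊔n≤o⇒n≤o (N₁ ℕ.⊔ N₂) N₃ N≤n)
          in ℚ.≤-trans
            (overshoot
              {seq δ n} {invℚ (seq δ n)} {⟦ length X ⟧} {⟦ ∣ B ∣ ⟧}
              {⟦ ∣ X ⊕ B ∣ ⟧} {seq K n} {e} {ε}
              -- Past this index `seq δ n` is at least `e > 0`, so `invℚ` returns the true
              -- reciprocal and not its default value at 0.
              (invℚ-inverseʳ (ℚ.<-≤-trans e>0 e≤δ)) (ℚ.<⇒≤ e>0) e≤δ (ℚ.<⇒≤ ε>0)
              (⟦⟧-mono-≤ (nonEmpty⇒∣∣≥1 B≢∅))
              (h₁ n (ℕ.m⊔n≤o⇒m≤o N₁ N₂ N₁₂≤n))
              -- `Growth` counts list entries; the excess of |X| carries over to `length X`, which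
              -- is at least as large.
              (ℚ.≤-trans (h₂ n (ℕ.m⊔n≤o⇒n≤o N₁ N₂ N₁₂≤n))
                (⟦⟧-mono-≤ (∣∣≤length X))))
            (⟦⟧-mono-≤ (∣∣-mono {X ⊕ B} {A ⊕ B} (⊕-monoˡ {X} {A} B X⊆A))))

lemma2p2 : ∀ {c ℓ} (em : ExcludedMiddle ℓ) (G : AbelianGroup c ℓ) →
    let open AbelianGroup G using (Carrier)
        open FiniteSubsets em G
    in (A B : FinSubset) → NonEmpty A → NonEmpty B →
       (K : ℝ) → fromℕ ∣ A ⊕ B ∣ ≤ K * fromℕ ∣ B ∣ →
       (δ : ℝ) (δ>0 : 0ℝ < δ) → δ ≤ 1ℝ →
       ∃[ X ] X ⊆ A
            × fromℕ ∣ X ∣ ≤ inverse δ δ>0 * (K - 1ℝ) + 1ℝ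
            × ((x : Carrier) → x ∈ A →
                 (1ℝ - δ) * fromℕ ∣ B ∣ ≤ fromℕ ∣ (x +ˢ B) ∩ (X ⊕ B) ∣)
lemma2p2 em G []      B (_ , ())
lemma2p2 em G (a ∷ A) B _ B≢∅ K A⊕B≤KB δ δ>0 _ =
  let open Greedy em G B δ δ>0
      X , X⊆A , gr , cov = greedy a A
  in X , X⊆A , growth⇒size-bound (a ∷ A) X B≢∅ X⊆A gr K A⊕B≤KB , cov
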